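{- Let $a,b\in\Sigma$ be actions and $p\in\{1,2\}$ a party. If $a\bowtie b$ (i.e. $a$ and $b$ are mutually exclusive), then (i) $\mathcal{O}_p(!a)\sqsubseteq\mathcal{O}_p(b)$; and (ii) $\mathcal{P}_p(!a)\sqsubseteq\mathcal{P}_p(b)$.
   Context: Parties are $p\in\{1,2\}$; $\overline{p}$ is the other party. A multi-action automaton is a tuple $\langle\Sigma,Q,q0,\rightarrow\rangle$ with $\Sigma$ an alphabet of actions, $Q$ a set of states, $q0\in Q$ initial, and ${\rightarrow}\subseteq Q\times 2^\Sigma\times Q$. Write $q\xrightarrow{A}q'$ for $(q,A,q')\in{\rightarrow}$ and $\mathrm{acts}(q)=\{A\mid\exists q'.\ q\xrightarrow{A}q'\}$. It is total if for every $q\in Q$, $A\subseteq\Sigma$ there is $q'$ with $q\xrightarrow{A}q'$. The synchronous composition $S_1\|_G S_2$ of two automata over $\Sigma$ has state set $Q_1\times Q_2$, initial state $(q0_1,q0_2)$ and transitions: $(q_1,q_2)\xrightarrow{A}(q_1',q_2)$ if $q_1\xrightarrow{A}_1q_1'$ and $A\cap G=\emptyset$; $(q_1,q_2)\xrightarrow{A}(q_1,q_2')$ if $q_2\xrightarrow{A}_2q_2'$ and $A\cap G=\emptyset$; $(q_1,q_2)\xrightarrow{A\cup B}(q_1',q_2')$ if $q_1\xrightarrow{A}_1q_1'$, $q_2\xrightarrow{B}_2q_2'$ and $A\cap G=B\cap G\neq\emptyset$. $\Sigma!=\Sigma\cup\{!a\mid a\in\Sigma\}$, where $!a$ denotes absence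 of $a$, and $!x$ means $a$ when $x={!a}$. A clause is $\mathcal{O}_p(x)$ (party $p$ is obliged to perform $x$) or $\mathcal{P}_p(x)$ (party $p$ is permitted to perform $x$), $x\in\Sigma!$, $p\in\{1,2\}$. A contract automaton is a total, deterministic multi-action automaton with a total function $\mathrm{contract}$ assigning a set of clauses to each state. A regulated two-party system $R=\langle S_1,S_2\rangle^{\mathcal A}_G$ consists of multi-action automata $S_1,S_2$ (behaviours of parties 1 and 2, with alphabets $\Sigma_1,\Sigma_2$, $\Sigma=\Sigma_1\cup\Sigma_2$), a set $G$ of synchronised actions, and a contract automaton $\mathcal A$ over $\Sigma$. Its behaviour is the automaton $(S_1\|_GS_2)\|_\Sigma\mathcal A$, with states written $(q_1,q_2)_{q_{\mathcal A}}$. All systems are assumed well-formed: $\mathrm{acts}((q_1,q_2))\ne\emptyset$ for all states $(q_1,q_2)$ of $S_1\|_GS_2$. $G^c$ is the complement of $G$ in $\Sigma$. Let $O_p(q_{\mathcal A})=\{a\mid\mathcal{O}_p(a)\in\mathrm{contract}(q_{\mathcal A})\}$, $F_p(q_{\mathcal A})=\{a\mid\mathcal{O}_p(!a)\in\mathrm{contract}(q_{\mathcal A})\}$, and $\mathrm{viable}_p(q_{\mathcal A},A)$ iff $O_p(q_{\mathcal A})\subseteq A$ and $F_p(q_{\mathcal A})\cap A=\emptyset$. Satisfaction (of $\mathcal A$, by a party, at a state or transition $X$ of the behaviour): - Permission. A clause $\mathcal{P}_p(a)$ is always satisfied by $p$; it is satisfied by $\overline p$ at state $(q_1,q_2)_{q_{\mathcal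 A}}$ iff $a\in G$ implies $\exists A\in\mathrm{acts}(q_{\overline p}),A'\subseteq G^c$ with $a\in A$ and $\mathrm{viable}_p(q_{\mathcal A},A\cup A')$. The clause $\mathcal{P}_p(!a)$ is treated identically with $a\notin A$ in place of $a\in A$. $\mathrm{sat}^P_p((q_1,q_2)_{q_{\mathcal A}})$ holds iff every clause $\mathcal{P}_{\overline p}(x)\in\mathrm{contract}(q_{\mathcal A})$ is satisfied by $p$ there; $\mathrm{sat}^P_p$ is true on all transitions. - Obligation. On a transition $(q_1,q_2)_{q_{\mathcal A}}\xrightarrow{A}(q_1',q_2')_{q_{\mathcal A}'}$, $\mathrm{sat}^O_p$ holds iff $\mathrm{viable}_p(q_{\mathcal A},A)$, except that it is true if $A$ is performed asynchronously by $\overline p$. On a state, $\mathrm{sat}^O_{\overline p}((q_1,q_2)_{q_{\mathcal A}})$ holds iff $\exists A\in\mathrm{acts}(q_{\overline p}),A'\subseteq G^c$ with $\mathrm{viable}_p(q_{\mathcal A},A\cup A')$. - $\mathrm{sat}^{\mathcal A}_p(X)$ iff $\mathrm{sat}^P_p(X)\wedge\mathrm{sat}^O_p(X)$. $\mathrm{breachIncapable}_p(R)$ holds if $\mathrm{sat}^{\mathcal A}_p(X)$ holds for all reachable states and transitions $X$ of the behaviour of $R$. Strictness of contract automata: $\mathcal A\sqsubseteq_p\mathcal A'$ iff for all systems $S_1,S_2$, $\mathrm{breachIncapable}_p(\langle S_1,S_2\rangle^{\mathcal A'}_G)\Rightarrow\mathrm{breachIncapable}_p(\langle S_1,S_2\rangle^{\mathcal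 A}_G)$; $\mathcal A\sqsubseteq\mathcal A'$ iff $\mathcal A\sqsubseteq_p\mathcal A'$ for both parties. Strictness of clauses: $[C\rightarrow C']$ relates $\mathcal A$ to $\mathcal A'$ if they are the same except possibly for a number of instances of clause $C$ (in $\mathcal A$) replaced by $C'$ (in $\mathcal A'$). $C\sqsubseteq_pC'$ ($C'$ is stricter than $C$ for $p$) iff $\mathcal A\sqsubseteq_p\mathcal A'$ for all $(\mathcal A,\mathcal A')\in[C\rightarrow C']$; $C\sqsubseteq C'$ iff this holds for both parties. Mutual exclusion: two actions $a,b\in\Sigma$ are mutually exclusive, $a\bowtie b$, if they never appear in the same set of actions on a transition: for every automaton describing behaviour (the party automata $S_1,S_2$ and the composed systems, not the total contract automata), every transition $(q,A,q')$ satisfies $a\in A\Rightarrow b\notin A$. Systems $S_1,S_2$ are restricted accordingly. Standing assumption: mutually exclusive actions never appear in the synchronisation set $G$.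
   Formalization: In the state conditions, the joint action set A∪A′ is also required to respect mutual exclusion. Without this (i) fails: with G=∅, both parties looping on {a} and p=1, party 2 is breach-incapable under O_1(b) via A′={b}, but not under O_1(!a). -}

module Defs where

open import Data.Bool using (Bool; T)
open import Data.Empty using (⊥)
open import Data.Product using (∃; ∃₂; _×_; _,_; proj₁; proj₂)
open import Data.Unit using (⊤)
open import Level using (0ℓ)
open import Relation.Binary.Core using (Rel)
open import Relation.Binary.Construct.Closure.ReflexiveTransitive using (Star)
open import Relation.Binary.PropositionalEquality using (_≡_; subst)
open import Relation.Nullary using (¬_)
open import Relation.Unary

------------------------------------------------------------------------
-- Parties and clauses

data Party : Set where
  party₁ party₂ : Party

other : Party → Party
other party₁ = party₂
other party₂ = party₁

-- Σ!
data Literal (Σ : Set) : Set where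
  act : Σ → Literal Σ
  !_  : Σ → Literal Σ

data Clause (Σ : Set) : Set where
  𝒪 𝒫 : Party → Literal Σ → Clause Σ

------------------------------------------------------------------------
-- Multi-action automata

-- Transition labels are decidable sets.  With labels in Pred Σ 0ℓ, a total
-- deterministic automaton could not branch on whether an action occurs.
2^_ : Set → Set
2^ Σ = Σ → Bool

⟦_⟧ : {Σ : Set} → 2^ Σ → Pred Σ 0ℓ
⟦ A ⟧ x = T (A x)

record Automaton (Σ : Set) : Set₁ where
  field
    State    : Set
    initial  : State
    _—[_]→_  : State → 2^ Σ → State → Set
    -- labels are sets, so they matter only up to extensional equality
    respects : ∀ {q q′ A B} → ⟦ A ⟧ ≐ ⟦ B ⟧ → q —[ A ]→ q′ → q —[ B ]→ q′

  acts : State → Pred (2^ Σ) 0ℓ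
  acts q A = ∃ λ q′ → q —[ A ]→ q′

  Reachable : Pred State 0ℓ
  Reachable = Star (λ q q′ → ∃ λ A → q —[ A ]→ q′) initial

  Total : Set
  Total = ∀ q A → ∃ λ q′ → q —[ A ]→ q′

  Deterministic : Set
  Deterministic = ∀ {q A q′ q″} → q —[ A ]→ q′ → q —[ A ]→ q″ → q′ ≡ q″

  Labels⊆ : Pred (Pred Σ 0ℓ) 0ℓ
  Labels⊆ Σ′ = ∀ {q A q′} → q —[ A ]→ q′ → ⟦ A ⟧ ⊆ Σ′

open Automaton using (State; initial; acts; Reachable)

module Composition {Σ : Set} (M₁ : Automaton Σ) (G : Pred Σ 0ℓ) (M₂ : Automaton Σ) where
  open Automaton M₁ using () renaming (_—[_]→_ to _—[_]→₁_; respects to respects₁)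
  open Automaton M₂ using () renaming (_—[_]→_ to _—[_]→₂_; respects to respects₂)

  data Step : State M₁ × State M₂ → 2^ Σ → State M₁ × State M₂ → Set where
    left  : ∀ {q₁ q₂ q₁′ A} → q₁ —[ A ]→₁ q₁′ → Empty (⟦ A ⟧ ∩ G) →
            Step (q₁ , q₂) A (q₁′ , q₂)
    right : ∀ {q₁ q₂ q₂′ A} → q₂ —[ A ]→₂ q₂′ → Empty (⟦ A ⟧ ∩ G) →
            Step (q₁ , q₂) A (q₁ , q₂′)
    both  : ∀ {q₁ q₂ q₁′ q₂′ A B C} → q₁ —[ A ]→₁ q₁′ → q₂ —[ B ]→₂ q₂′ →
            ⟦ A ⟧ ∩ G ≐ ⟦ B ⟧ ∩ G → Satisfiable (⟦ A ⟧ ∩ G) →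
            ⟦ C ⟧ ≐ ⟦ A ⟧ ∪ ⟦ B ⟧ →
            Step (q₁ , q₂) C (q₁′ , q₂′)

  Step-respects : ∀ {q q′ A B} → ⟦ A ⟧ ≐ ⟦ B ⟧ → Step q A q′ → Step q B q′
  Step-respects A≐B (left t d) =
    left (respects₁ A≐B t) (λ x (x∈B , x∈G) → d x (proj₂ A≐B x∈B , x∈G))
  Step-respects A≐B (right t d) =
    right (respects₂ A≐B t) (λ x (x∈B , x∈G) → d x (proj₂ A≐B x∈B , x∈G))
  Step-respects A≐B (both t₁ t₂ e s (C⊆ , ⊆C)) =
    both t₁ t₂ e s ((λ x∈B → C⊆ (proj₂ A≐B x∈B)) , (λ x∈∪ → proj₁ A≐B (⊆C x∈∪)))

  composition : Automaton Σ
  composition = record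
    { State    = State M₁ × State M₂
    ; initial  = initial M₁ , initial M₂
    ; _—[_]→_  = Step
    ; respects = Step-respects
    }

open Composition using (left; right; both)

_∥[_]_ : {Σ : Set} → Automaton Σ → Pred Σ 0ℓ → Automaton Σ → Automaton Σ
M₁ ∥[ G ] M₂ = Composition.composition M₁ G M₂

------------------------------------------------------------------------
-- Contract automata

record ContractAutomaton (Σ : Set) : Set₁ where
  field
    automaton     : Automaton Σ
    total         : Automaton.Total automaton
    deterministic : Automaton.Deterministic automaton
    contract      : State automaton → Pred (Clause Σ) 0ℓ

open ContractAutomaton using (automaton; contract)

data Replaced {Σ : Set} (C C′ : Clause Σ) (c c′ : Pred (Clause Σ) 0ℓ) : Set where
  kept     : c′ ≐ c → Replaced C C′ c c′
  replaced : C ∈ c → c′ ≐ (c ∖ ｛ C ｝) ∪ ｛ C′ ｝ → Replaced C C′ c c′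

record [_⟶_] {Σ : Set} (C C′ : Clause Σ) (𝒜 𝒜′ : ContractAutomaton Σ) : Set₁ where
  field
    same      : automaton 𝒜 ≡ automaton 𝒜′
    contracts : ∀ q → Replaced C C′ (contract 𝒜 q) (contract 𝒜′ (subst State same q))

module _ {Σ : Set} where

  obliged forbidden : Party → Pred (Clause Σ) 0ℓ → Pred Σ 0ℓ
  obliged   p c a = 𝒪 p (act a) ∈ c
  forbidden p c a = 𝒪 p (! a) ∈ c

  viable : Party → Pred (Clause Σ) 0ℓ → Pred (Pred Σ 0ℓ) 0ℓ
  viable p c A = obliged p c ⊆ A × Empty (forbidden p c ∩ A)

  action : Literal Σ → Σ
  action (act a) = a
  action (! a)   = a

  _⊨_ : 2^ Σ → Literal Σ → Set
  A ⊨ act a = a ∈ ⟦ A ⟧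
  A ⊨ (! a) = a ∉ ⟦ A ⟧

------------------------------------------------------------------------
-- Regulated two-party systems

-- The mutual-exclusion relation _⋈_ is given together with Σ and G; the
-- systems considered are those whose behaviours respect it.
module Strictness {Σ : Set} (G : Pred Σ 0ℓ) (_⋈_ : Rel Σ 0ℓ) where

  Exclusive : Pred (Pred Σ 0ℓ) 0ℓ
  Exclusive A = ∀ {a b} → a ⋈ b → a ∈ A → b ∉ A

  RespectsExclusion : Automaton Σ → Set
  RespectsExclusion M = ∀ {q A q′} → q —[ A ]→ q′ → Exclusive ⟦ A ⟧
    where open Automaton M using (_—[_]→_)

  record System : Set₁ where
    field
      S₁ S₂      : Automaton Σ
      Σ₁ Σ₂      : Pred Σ 0ℓ
      labels₁    : Automaton.Labels⊆ S₁ Σ₁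
      labels₂    : Automaton.Labels⊆ S₂ Σ₂
      Σ₁∪Σ₂      : Universal (Σ₁ ∪ Σ₂)
      wellFormed : ∀ q → Satisfiable (acts (S₁ ∥[ G ] S₂) q)
      exclusive₁ : RespectsExclusion S₁
      exclusive₂ : RespectsExclusion S₂
      exclusive  : RespectsExclusion (S₁ ∥[ G ] S₂)

    party : Party → Automaton Σ
    party party₁ = S₁
    party party₂ = S₂

    local : ∀ p → State (S₁ ∥[ G ] S₂) → State (party p)
    local party₁ = proj₁
    local party₂ = proj₂

  module _ (S : System) where
    open System S

    SystemAsyncBy : ∀ {q A q′} → Party → Composition.Step S₁ G S₂ q A q′ → Set
    SystemAsyncBy party₁ (left _ _)  = ⊤
    SystemAsyncBy party₂ (right _ _) = ⊤
    SystemAsyncBy _      _           = ⊥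

    -- A step of the contract automaton alone (necessarily labelled by the empty
    -- set) is performed by neither party.
    AsyncBy : ∀ {M q A q′} → Party → Composition.Step (S₁ ∥[ G ] S₂) U M q A q′ → Set
    AsyncBy p (left t _)       = SystemAsyncBy p t
    AsyncBy p (right _ _)      = ⊥
    AsyncBy p (both t _ _ _ _) = SystemAsyncBy p t

  module Regulated (S : System) (𝒜 : ContractAutomaton Σ) where
    open System S

    behaviour : Automaton Σ
    behaviour = (S₁ ∥[ G ] S₂) ∥[ U ] automaton 𝒜

    open Automaton behaviour using (_—[_]→_)

    clauses : State behaviour → Pred (Clause Σ) 0ℓ
    clauses (_ , q𝒜) = contract 𝒜 q𝒜

    -- Party p offers some A satisfying P which, together with actions A′
    -- outside G, is viable for the other party.  A ∪ A′ stands for a set of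
    -- actions performed jointly, so mutual exclusion applies to it: without
    -- that, an offer {a} could be completed by A′ = {b} even when a ⋈ b.
    Offers : Party → Pred (2^ Σ) 0ℓ → Pred (State behaviour) 0ℓ
    Offers p P q@(qS , _) = ∃₂ λ (A A′ : 2^ Σ) →
      A ∈ acts (party p) (local p qS) ×
      ⟦ A′ ⟧ ⊆ ∁ G ×
      Exclusive (⟦ A ⟧ ∪ ⟦ A′ ⟧) ×
      A ∈ P ×
      viable (other p) (clauses q) (⟦ A ⟧ ∪ ⟦ A′ ⟧)

    satᴾ satᴼ sat : Party → Pred (State behaviour) 0ℓ
    satᴾ p q = ∀ {x} → 𝒫 (other p) x ∈ clauses q → action x ∈ G → Offers p (_⊨ x) q
    satᴼ p q = Offers p U q
    sat  p q = satᴾ p q × satᴼ p q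

    satᴾ→ satᴼ→ sat→ : ∀ {q A q′} → Party → q —[ A ]→ q′ → Set
    satᴾ→ p t = ⊤
    satᴼ→ {q} {A} p t = ¬ AsyncBy S (other p) t → viable p (clauses q) ⟦ A ⟧
    sat→  p t = satᴾ→ p t × satᴼ→ p t

    BreachIncapable : Party → Set
    BreachIncapable p = ∀ {q} → Reachable behaviour q →
      sat p q × (∀ {A q′} (t : q —[ A ]→ q′) → sat→ p t)

  _⊑ᴬ[_]_ : ContractAutomaton Σ → Party → ContractAutomaton Σ → Set₁
  𝒜 ⊑ᴬ[ p ] 𝒜′ = ∀ (S : System) →
    Regulated.BreachIncapable S 𝒜′ p → Regulated.BreachIncapable S 𝒜 p

  _⊑[_]_ : Clause Σ → Party → Clause Σ → Set₁
  C ⊑[ p ] C′ = ∀ {𝒜 𝒜′} → [ C ⟶ C′ ] 𝒜 𝒜′ → 𝒜 ⊑ᴬ[ p ] 𝒜′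

  _⊑_ : Clause Σ → Clause Σ → Set₁
  C ⊑ C′ = ∀ p → C ⊑[ p ] C′

{-# OPTIONS --safe #-}
-- Relaxing a contract preserves breach incapability if, state by state, every
-- mutually exclusive set of actions viable for the strict contract is viable for
-- the relaxed one, and no permission over a synchronised action is added.
-- For (i), a viable set that must contain b cannot contain a.  For (ii), viability
-- ignores permissions, and a is not synchronised.
module Submission where

open import Defs
open import Data.Product using (_×_; _,_; proj₁; proj₂)
open import Data.Sum using (inj₁; inj₂)
open import Data.Unit using (tt)
open import Level using (0ℓ)
open import Relation.Binary.Core using (Rel)
open import Relation.Binary.PropositionalEquality using (_≡_; _≢_; refl; subst)
open import Relation.Unary using (Pred; _∈_; _∉_; _⊆_; U)

open Automaton using (State)
open Composition using (left; right; both)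
open ContractAutomaton using (automaton; contract)

module _ {Σ : Set} where

  Replaced-retains : ∀ {C C′ D : Clause Σ} {c c′} →
                     Replaced C C′ c c′ → C ≢ D → D ∈ c → D ∈ c′
  Replaced-retains (kept (_ , c⊆c′))       _   D∈c = c⊆c′ D∈c
  Replaced-retains (replaced _ (_ , ⊆c′)) C≢D D∈c = ⊆c′ (inj₁ (D∈c , C≢D))

module _ {Σ : Set} (G : Pred Σ 0ℓ) (_⋈_ : Rel Σ 0ℓ) where
  open Strictness G _⋈_

  -- Viability is compared for every party `r` because an offer by one party is judged by the
  -- viability of the other. Permissions matter only inside `G`: elsewhere `satᴾ` holds vacuously.
  record Relaxes (c c′ : Pred (Clause Σ) 0ℓ) : Set₁ where
    field
      viable-relax : ∀ r {A} → Exclusive A → viable r c′ A → viable r c A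
      permission   : ∀ {r x} → action x ∈ G → 𝒫 r x ∈ c → 𝒫 r x ∈ c′

  -- Labels of `M` may contain excluded pairs. Synchronising on `U` forces a joint label to coincide
  -- with the system's own, and a lone contract step carries the empty label.
  step-exclusive : ∀ (S : System) (M : Automaton Σ) → let open System S in
                   RespectsExclusion ((S₁ ∥[ G ] S₂) ∥[ U ] M)
  step-exclusive S M (left t _)  = System.exclusive S t
  step-exclusive S M (right _ A∩U=∅) _ a∈A _ = A∩U=∅ _ (a∈A , tt)
  step-exclusive S M (both {A = A} {C = C} t _ (_ , B⊆A) _ (C⊆A∪B , _)) a⋈b a∈C b∈C =
    System.exclusive S t a⋈b (C⊆A a∈C) (C⊆A b∈C)
    where
    C⊆A : ⟦ C ⟧ ⊆ ⟦ A ⟧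
    C⊆A x∈C with C⊆A∪B x∈C
    ... | inj₁ x∈A = x∈A
    ... | inj₂ x∈B = proj₁ (B⊆A (x∈B , tt))

  relaxes⇒⊑ᴬ : ∀ 𝒜 𝒜′ (same : automaton 𝒜 ≡ automaton 𝒜′) →
               (∀ q → Relaxes (contract 𝒜 q) (contract 𝒜′ (subst State same q))) →
               ∀ r → 𝒜 ⊑ᴬ[ r ] 𝒜′
  -- Matching `refl` gives both regulated systems the same behaviour, so reachability and
  -- transitions carry over unchanged.
  relaxes⇒⊑ᴬ 𝒜@record { automaton = M } 𝒜′@record {} refl relaxes r S incapable {q} reach
    with incapable reach
  ... | (permits , obliges) , steps =
        ( (λ P∈c x∈G → offers (permits (permission x∈G P∈c) x∈G))
        , offers obliges )
      , λ t → tt , λ ¬async →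
          viable-relax r (step-exclusive S M t) (proj₂ (steps t) ¬async)
    where
    open Relaxes (relaxes (proj₂ q))
    offers : ∀ {P} → Regulated.Offers S 𝒜′ r P q → Regulated.Offers S 𝒜 r P q
    offers (A , A′ , A∈acts , A′⊆∁G , ex , A∈P , v) =
      A , A′ , A∈acts , A′⊆∁G , ex , A∈P , viable-relax (other r) ex v

  replacement⇒⊑ : ∀ {C C′} → (∀ {c c′} → Replaced C C′ c c′ → Relaxes c c′) → C ⊑ C′
  replacement⇒⊑ relaxes r {𝒜} {𝒜′} C⟶C′ =
    relaxes⇒⊑ᴬ 𝒜 𝒜′ same (λ q → relaxes (contracts q)) r
    where open [_⟶_] C⟶C′

  obligation-relaxes : ∀ {a b p} → a ⋈ b → ∀ {c c′} →
                       Replaced (𝒪 p (! a)) (𝒪 p (act b)) c c′ → Relaxes c c′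
  obligation-relaxes a⋈b (kept (c′⊆c , c⊆c′)) = record
    { viable-relax = λ r _ (O⊆A , F∩A=∅) →
        (λ O∈c → O⊆A (c⊆c′ O∈c)) , λ x (F∈c , x∈A) → F∩A=∅ x (c⊆c′ F∈c , x∈A)
    ; permission   = λ _ → c⊆c′
    }
  obligation-relaxes a⋈b R@(replaced _ (_ , ⊆c′)) = record
    { viable-relax = λ r ex (O⊆A , F∩A=∅) →
        (λ O∈c → O⊆A (Replaced-retains R (λ ()) O∈c)) ,
        λ x (F∈c , x∈A) → F∩A=∅ x
          ( Replaced-retains R
              -- Only the replaced prohibition can be lost, and then `x` is `a`; but `c′` obliges
              -- `p` to perform `b`, so `b` lies in the set too, against exclusion.
              (λ { refl → ex a⋈b x∈A (O⊆A (⊆c′ (inj₂ refl))) }) F∈c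
          , x∈A )
    ; permission   = λ _ → Replaced-retains R (λ ())
    }

  -- `C′` is arbitrary: adding a clause to `c′` can only shrink its viable sets or enlarge its
  -- permissions.
  permission-relaxes : ∀ {p x C′} → action x ∉ G → ∀ {c c′} →
                       Replaced (𝒫 p x) C′ c c′ → Relaxes c c′
  permission-relaxes x∉G R = record
    { viable-relax = λ r _ (O⊆A , F∩A=∅) →
        (λ O∈c → O⊆A (Replaced-retains R (λ ()) O∈c)) ,
        λ x (F∈c , x∈A) → F∩A=∅ x (Replaced-retains R (λ ()) F∈c , x∈A)
    ; permission   = λ y∈G → Replaced-retains R (λ { refl → x∉G y∈G })
    }

theorem3 : {Σ : Set} (G : Pred Σ 0ℓ) (_⋈_ : Rel Σ 0ℓ) →
    (∀ {x y} → x ⋈ y → x ∉ G × y ∉ G) →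
    let open Strictness G _⋈_ in
    ∀ (a b : Σ) (p : Party) → a ⋈ b →
    (𝒪 p (! a) ⊑ 𝒪 p (act b)) × (𝒫 p (! a) ⊑ 𝒫 p (act b))
theorem3 G _⋈_ ⋈⇒∉G a b p a⋈b =
  replacement⇒⊑ G _⋈_ (obligation-relaxes G _⋈_ a⋈b) ,
  replacement⇒⊑ G _⋈_ (permission-relaxes G _⋈_ (proj₁ (⋈⇒∉G a⋈b)))
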